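{- Let $X$ be a finite set with $|X|\ge 2$ and let $\mathbb{M}_X$ be the free monoid with basis $X$. The basis $X$ consists of all irreducible elements of $\mathbb{M}_X$ and is definable without parameters in $\mathbb{M}_X$; thus the set of primitive elements of $\mathbb{M}_X$ and, therefore, the set of free bases of $\mathbb{M}_X$ (as a set of $|X|$-tuples) are definable in $\mathbb{M}_X$.
   Context: A subset $A\subseteq\mathbb{M}_X^n$ is definable in $\mathbb{M}_X$ if it is the solution set of a first-order formula in the language of monoids. A non-trivial element of a monoid is irreducible if it is not a product of two non-trivial elements. An element is primitive if it belongs to some free basis of $\mathbb{M}_X$. -}

module Defs where

open import Level using (suc)
open import Algebra.Bundles using (Monoid)
open import Data.Empty.Polymorphic using (⊥)
open import Data.Fin using (Fin)
open import Data.List using (List; foldr; [_])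
open import Data.List.Relation.Binary.Pointwise using (Pointwise)
open import Data.List.Relation.Unary.All using (All)
open import Data.Nat as ℕ using (ℕ)
open import Data.Product using (Σ-syntax; ∃; ∃!; _×_)
open import Data.Sum using (_⊎_)
open import Data.Vec using (Vec; _∷_; lookup; head)
open import Function using (_⇔_; _∘_)
open import Function.Definitions using (Injective)
open import Relation.Binary.PropositionalEquality using (_≡_)
open import Relation.Nullary using (¬_)
open import Relation.Unary using (Pred)

infixl 7 _·_
infix  6 _≐ₜ_
infixr 5 _∧_
infixr 4 _∨_
infixr 3 _⇒_

data Term (n : ℕ) : Set where
  var : Fin n → Term n
  one : Term n
  _·_ : Term n → Term n → Term n

-- First-order formulas over (·, 1) with n free variables. Variables are de
-- Bruijn indices: a quantifier binds index zero of its body. There are no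
-- constants besides the identity, hence no parameters. Negation of φ is
-- φ ⇒ false.
data Formula (n : ℕ) : Set where
  _≐ₜ_        : Term n → Term n → Formula n
  false       : Formula n
  _∧_ _∨_ _⇒_ : Formula n → Formula n → Formula n
  all′ ex′    : Formula (ℕ.suc n) → Formula n

module _ {a} (M : Monoid a a) where
  open Monoid M

  eval : ∀ {n} → Vec Carrier n → Term n → Carrier
  eval ρ (var i) = lookup ρ i
  eval ρ one     = ε
  eval ρ (s · t) = eval ρ s ∙ eval ρ t

  Satisfies : ∀ {n} → Vec Carrier n → Formula n → Set a
  Satisfies ρ (s ≐ₜ t) = eval ρ s ≈ eval ρ t
  Satisfies ρ false    = ⊥
  Satisfies ρ (φ ∧ ψ)  = Satisfies ρ φ × Satisfies ρ ψ
  Satisfies ρ (φ ∨ ψ)  = Satisfies ρ φ ⊎ Satisfies ρ ψ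
  Satisfies ρ (φ ⇒ ψ)  = Satisfies ρ φ → Satisfies ρ ψ
  Satisfies ρ (all′ φ) = ∀ x → Satisfies (x ∷ ρ) φ
  Satisfies ρ (ex′ φ)  = ∃ λ x → Satisfies (x ∷ ρ) φ

  Definable : ∀ {n ℓ} → Pred (Vec Carrier n) ℓ → Set _
  Definable {n} A = Σ[ φ ∈ Formula n ] (∀ v → A v ⇔ Satisfies v φ)

  -- Subsets of M are identified with sets of 1-tuples.
  Definable₁ : ∀ {ℓ} → Pred Carrier ℓ → Set _
  Definable₁ A = Definable {1} (A ∘ head)

  Irreducible : Pred Carrier a
  Irreducible x =
    ¬ (x ≈ ε) × ¬ (∃ λ u → ∃ λ v → ¬ (u ≈ ε) × ¬ (v ≈ ε) × x ≈ u ∙ v)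

  -- M is free on the subset B: every element is the product of exactly one
  -- finite sequence (word) of elements of B.
  IsFreeBasis : Pred Carrier a → Set a
  IsFreeBasis B =
    ∀ x → ∃! (Pointwise _≈_) λ ws → All B ws × foldr _∙_ ε ws ≈ x

  Primitive : Pred Carrier (suc a)
  Primitive x = Σ[ B ∈ Pred Carrier a ] (IsFreeBasis B × B x)

  -- The tuple lists the elements of a free basis without repetition.
  IsFreeBasisTuple : ∀ {n} → Pred (Vec Carrier n) a
  IsFreeBasisTuple b =
    Injective _≡_ _≈_ (lookup b) × IsFreeBasis (λ x → ∃ λ i → x ≈ lookup b i)

-- The basis X inside the free monoid of words over X: one-letter words.
Letter : ∀ {a} (X : Set a) → Pred (List X) a
Letter X w = ∃ λ x → w ≡ [ x ]

{-# OPTIONS --safe #-}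
module Submission where

-- In a free monoid of words the letters are exactly the irreducible elements, and
-- they form the only free basis: an element of a free basis B that split as u v would have
-- both itself and the concatenated factorisations of u and v as factorisations over B, and a
-- letter, being irreducible, has to be one of its own factors.  So the primitive
-- elements are the letters, and an n-tuple is a free basis iff its entries are exactly
-- the letters; there being n letters, the entries are then distinct.

open import Defs
open import Data.Empty using (⊥-elim)
open import Data.Empty.Polymorphic using () renaming (⊥-elim to ⊥ₗ-elim)
open import Data.Fin using (Fin; zero; suc; _<_)
open import Data.Fin.Properties using (pigeonhole; <⇒≢)
open import Data.List using (List; []; _∷_; [_]; _++_; concat; map)
open import Data.List.Properties using (++-monoid; ++-identityʳ; concat-++; concat-map-[_]; ∷-injectiveˡ)
open import Data.List.Relation.Binary.Pointwise
  using (Pointwise; []; _∷_; Pointwise-≡⇒≡)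
open import Data.List.Relation.Unary.All using (All; []; _∷_)
open import Data.List.Relation.Unary.All.Properties using (++⁺)
open import Data.Nat using (ℕ; zero; suc; _≤_)
open import Data.Nat.Properties using (n<1+n)
open import Data.Product using (_×_; _,_; ∃; proj₁; proj₂)
open import Data.Sum using (_⊎_; inj₁; inj₂) renaming ([_,_] to ⊎-elim)
open import Data.Vec using (Vec; _∷_; []; lookup)
open import Function using (_∘_; _⇔_; mk⇔; Equivalence)
open import Function.Bundles using (_↔_; Inverse)
open import Function.Construct.Composition using (_⇔-∘_)
open import Function.Definitions using (Injective)
open import Relation.Binary.PropositionalEquality
  using (_≡_; _≢_; refl; sym; trans; cong; subst)
open import Relation.Nullary using (¬_)
open import Relation.Unary using (Pred; _≐_; _⊆_)

-- Prepending `y` to the `n` values of `f` forces a collision. Injectivity excludes one between two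
-- values of `f`, so the collision involves `y`.
injective⇒hits : ∀ {n} (f : Fin n → Fin n) → Injective _≡_ _≡_ f → ∀ y → ∃ λ i → f i ≡ y
injective⇒hits {n} f f-inj y = hit (pigeonhole (n<1+n n) g)
  where
  g : Fin (suc n) → Fin n
  g zero    = y
  g (suc i) = f i
  hit : (∃ λ i → ∃ λ j → i < j × g i ≡ g j) → ∃ λ i → f i ≡ y
  hit (zero  , suc j , _   , y≡fj)  = j , sym y≡fj
  hit (suc i , suc j , i<j , fi≡fj) = ⊥-elim (<⇒≢ i<j (cong suc (f-inj fi≡fj)))

⋁ : ∀ {m} k → (Fin k → Formula m) → Formula m
⋁ zero    φ = false
⋁ (suc k) φ = φ zero ∨ ⋁ k (φ ∘ suc)

-- Irreducibility with a disjunction in place of a negated existential. Constructively this is the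
-- stronger form; on words the two agree, since emptiness of a factor is decided by its shape.
letterFormula : ∀ {m} → Fin m → Formula m
letterFormula i =
  (var i ≐ₜ one ⇒ false) ∧
  all′ (all′ (var (suc (suc i)) ≐ₜ var (suc zero) · var zero
    ⇒ var (suc zero) ≐ₜ one ∨ var zero ≐ₜ one))

entriesAreLettersFormula : ∀ {n} → Formula n
entriesAreLettersFormula {n} = all′
  ((⋁ n isEntry ⇒ letterFormula zero) ∧ (letterFormula zero ⇒ ⋁ n isEntry))
  where
  isEntry : Fin n → Formula (suc n)
  isEntry i = var zero ≐ₜ var (suc i)

module _ {a} {X : Set a} where

  private
    M = ++-monoid X

  letter⇒irreducible : Letter X ⊆ Irreducible M
  letter⇒irreducible (x , refl) = (λ ()) , λ where
    ([]    , v , u≢[] , _ , _) → u≢[] refl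
    (_ ∷ [] , [] , _ , v≢[] , _) → v≢[] refl

  irreducible⇒letter : Irreducible M ⊆ Letter X
  irreducible⇒letter {[]}        (≢[] , _)  = ⊥-elim (≢[] refl)
  irreducible⇒letter {x ∷ []}    _          = x , refl
  irreducible⇒letter {x ∷ y ∷ w} (_ , ¬split) =
    ⊥-elim (¬split ([ x ] , y ∷ w , (λ ()) , (λ ()) , refl))

  satisfies-⋁ : ∀ {m} {ρ : Vec (List X) m} k {φ : Fin k → Formula m} →
    Satisfies M ρ (⋁ k φ) ⇔ ∃ λ i → Satisfies M ρ (φ i)
  satisfies-⋁ {ρ = ρ} k = mk⇔ (to k) (from k)
    where
    to : ∀ k {φ} → Satisfies M ρ (⋁ k φ) → ∃ λ i → Satisfies M ρ (φ i)
    to (suc k) (inj₁ p) = zero , p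
    to (suc k) (inj₂ q) = let i , p = to k q in suc i , p
    from : ∀ k {φ} → (∃ λ i → Satisfies M ρ (φ i)) → Satisfies M ρ (⋁ k φ)
    from (suc k) (zero  , p) = inj₁ p
    from (suc k) (suc i , p) = inj₂ (from k (i , p))

  satisfies-letterFormula : ∀ {m} (ρ : Vec (List X) m) i →
    Letter X (lookup ρ i) ⇔ Satisfies M ρ (letterFormula i)
  satisfies-letterFormula ρ i = mk⇔ to from
    where
    to : Letter X (lookup ρ i) → Satisfies M ρ (letterFormula i)
    to (x , eq) = (λ eq′ → ⊥-elim ([x]≢[] (trans (sym eq) eq′))) ,
      λ u v split → trivialFactor u v (trans (sym eq) split)
      where
      [x]≢[] : [ x ] ≢ []
      [x]≢[] ()
      trivialFactor : ∀ u v → [ x ] ≡ u ++ v → u ≡ [] ⊎ v ≡ []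
      trivialFactor []       v  _ = inj₁ refl
      trivialFactor (_ ∷ []) [] _ = inj₂ refl
    from : Satisfies M ρ (letterFormula i) → Letter X (lookup ρ i)
    from (≢[] , trivialFactor) = irreducible⇒letter
      ( (λ eq → ⊥ₗ-elim (≢[] eq))
      , λ (u , v , u≢[] , v≢[] , split) → ⊎-elim u≢[] v≢[] (trivialFactor u v split))

  module _ {B : Pred (List X) a} (basis : IsFreeBasis M B) where

    -- `∃!` only compares a factorisation with its own witness, so both lists are compared with the
    -- witness for the common product.
    factorisation-unique : ∀ {us vs} → All B us → All B vs → concat us ≡ concat vs → us ≡ vs
    factorisation-unique {us} {vs} us∈B vs∈B eq =
      let _ , _ , unique = basis (concat vs)
      in trans (sym (Pointwise-≡⇒≡ (unique (us∈B , eq))))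
               (Pointwise-≡⇒≡ (unique (vs∈B , refl)))

    basis⇒irreducible : B ⊆ Irreducible M
    basis⇒irreducible {w} w∈B = w≢[] , unsplittable
      where
      w≢[] : w ≢ []
      -- An empty word in `B` would factor both as `[ [] ]` and as the empty list.
      w≢[] refl with () ← factorisation-unique (w∈B ∷ []) [] refl

      unsplittable : ¬ (∃ λ u → ∃ λ v → u ≢ [] × v ≢ [] × w ≡ u ++ v)
      unsplittable (u , v , u≢[] , v≢[] , w≡uv) with basis u | basis v
      ... | us , (us∈B , refl) , _ | vs , (vs∈B , refl) , _ =
        oneFactor us vs u≢[] v≢[]
          (factorisation-unique (w∈B ∷ []) (++⁺ us∈B vs∈B)
            (trans (++-identityʳ w) (trans w≡uv (concat-++ us vs))))
        where
        -- By length, one of the two lists is empty, and then so is its product.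
        oneFactor : ∀ us vs → concat us ≢ [] → concat vs ≢ [] → ¬ ([ w ] ≡ us ++ vs)
        oneFactor []       vs us≢ vs≢ _ = us≢ refl
        oneFactor (_ ∷ []) [] us≢ vs≢ _ = vs≢ refl

    basis⇒letter : B ⊆ Letter X
    basis⇒letter = irreducible⇒letter ∘ basis⇒irreducible

    letter⇒basis : Letter X ⊆ B
    letter⇒basis (x , refl) with basis [ x ]
    -- The list of factors is nonempty because its product is `[ x ]`. Its head is a letter `[ y ]`,
    -- and comparing first characters gives `y ≡ x`.
    ... | w ∷ ws , (w∈B ∷ _ , eq) , _ with basis⇒letter w∈B
    ...   | y , refl = subst (B ∘ [_]) (∷-injectiveˡ eq) w∈B

  -- Cutting a word into one-letter pieces is its only factorisation into letters. Stating this for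
  -- any `B` with the same elements as `Letter X` lets it apply to `Entry b`.
  letters⇒isFreeBasis : {B : Pred (List X) a} → B ≐ Letter X → IsFreeBasis M B
  letters⇒isFreeBasis {B} (B⊆L , L⊆B) w =
    map [_] w , (singletons∈B w , concat-map-[_] w) , λ where (ws∈B , refl) → unique ws∈B
    where
    singletons∈B : ∀ w → All B (map [_] w)
    singletons∈B []      = []
    singletons∈B (x ∷ w) = L⊆B (x , refl) ∷ singletons∈B w
    -- Once the word is replaced by `concat ws`, the induction runs over the factors, each of which
    -- is a single letter.
    unique : ∀ {ws} → All B ws → Pointwise _≡_ (map [_] (concat ws)) ws
    unique [] = []
    unique (w∈B ∷ ws∈B) with B⊆L w∈B
    ... | _ , refl = refl ∷ unique ws∈B

  primitive⇔letter : ∀ {w} → Primitive M w ⇔ Letter X w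
  primitive⇔letter = mk⇔
    (λ (B , basis , w∈B) → basis⇒letter basis w∈B)
    (λ w∈L → Letter X , letters⇒isFreeBasis ((λ p → p) , (λ p → p)) , w∈L)

  Entry : ∀ {n} → Vec (List X) n → Pred (List X) a
  Entry b w = ∃ λ i → w ≡ lookup b i

  -- A choice of a position for every letter is an injection between sets of size n, so
  -- every position is chosen by some letter.
  allLetters⇒injective : ∀ {n} → X ↔ Fin n → (b : Vec (List X) n) →
    Letter X ⊆ Entry b → Injective _≡_ _≡_ (lookup b)
  allLetters⇒injective {n} X↔Fin b L⊆E {i} {j} bi≡bj =
    let k , pk≡i = injective⇒hits p p-injective i
        l , pl≡j = injective⇒hits p p-injective j
    in trans (sym pk≡i) (trans (cong p (pick-injective (trans (cong (lookup b) pk≡i)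
         (trans bi≡bj (cong (lookup b) (sym pl≡j)))))) pl≡j)
    where
    open Inverse X↔Fin using (to; from; strictlyInverseˡ)
    p : Fin n → Fin n
    p k = proj₁ (L⊆E (from k , refl))
    -- The entry at `p k` is the letter `from k`, so equal entries, even at different positions,
    -- come from equal letters. This is what turns `bi≡bj` into `k ≡ l`.
    pick-injective : ∀ {k l} → lookup b (p k) ≡ lookup b (p l) → k ≡ l
    pick-injective {k} {l} eq =
      trans (sym (strictlyInverseˡ k)) (trans (cong to (∷-injectiveˡ
        (trans (proj₂ (L⊆E (from k , refl))) (trans eq (sym (proj₂ (L⊆E (from l , refl))))))))
        (strictlyInverseˡ l))
    p-injective : Injective _≡_ _≡_ p
    p-injective = pick-injective ∘ cong (lookup b)

  isFreeBasisTuple⇔entriesAreLetters : ∀ {n} → X ↔ Fin n → (b : Vec (List X) n) →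
    IsFreeBasisTuple M b ⇔ Entry b ≐ Letter X
  isFreeBasisTuple⇔entriesAreLetters X↔Fin b = mk⇔
    (λ (_ , basis) → basis⇒letter basis , letter⇒basis basis)
    (λ (E⊆L , L⊆E) → allLetters⇒injective X↔Fin b L⊆E , letters⇒isFreeBasis (E⊆L , L⊆E))

  satisfies-entriesAreLettersFormula : ∀ {n} (b : Vec (List X) n) →
    Entry b ≐ Letter X ⇔ Satisfies M b entriesAreLettersFormula
  satisfies-entriesAreLettersFormula {n} b = mk⇔ to from
    where
    module _ (w : List X) where
      open Equivalence (satisfies-letterFormula (w ∷ b) zero) public
        using () renaming (to to letterTo; from to letterFrom)
      open Equivalence (satisfies-⋁ {ρ = w ∷ b} n) public
        using () renaming (to to entryTo; from to entryFrom)
    to : Entry b ≐ Letter X → Satisfies M b entriesAreLettersFormula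
    to (E⊆L , L⊆E) w =
      (λ e → letterTo w (E⊆L (entryTo w e))) , (λ l → entryFrom w (L⊆E (letterFrom w l)))
    from : Satisfies M b entriesAreLettersFormula → Entry b ≐ Letter X
    from sat =
        (λ {w} e → letterFrom w (proj₁ (sat w) (entryFrom w e)))
      , (λ {w} l → entryTo w (proj₂ (sat w) (letterTo w l)))

mainTheorem8 : ∀ {a} (X : Set a) (n : ℕ) → X ↔ Fin n → 2 ≤ n →
    (Letter X ≐ Irreducible (++-monoid X))
    × Definable₁ (++-monoid X) (Letter X)
    × Definable₁ (++-monoid X) (Primitive (++-monoid X))
    × Definable (++-monoid X) (IsFreeBasisTuple (++-monoid X) {n})
mainTheorem8 X n X↔Fin _ =
    (letter⇒irreducible , irreducible⇒letter)
  -- Splitting the 1-tuple makes `head ρ` and `lookup ρ zero` the same word.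
  , (letterFormula zero , λ where ρ@(_ ∷ []) → satisfies-letterFormula ρ zero)
  , (letterFormula zero , λ where
      ρ@(_ ∷ []) → satisfies-letterFormula ρ zero ⇔-∘ primitive⇔letter)
  , (entriesAreLettersFormula , λ b →
      satisfies-entriesAreLettersFormula b ⇔-∘ isFreeBasisTuple⇔entriesAreLetters X↔Fin b)
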